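{- Let $K$ be a field and $n\geq 0$. A polynomial $p(x)\in K[x]$ of degree $n$ is multiplicatively symmetric if and only if there is an additively symmetric polynomial $q(x)\in K[x]$ of degree $n$ satisfying $$ p(x)=x^{\frac{n}{2}} \left(q(\sqrt{x})+q\left(\frac{1}{\sqrt{x}}\right)-q(0)\right). $$ Moreover, $q(x)$ is uniquely determined.
   Context: A polynomial $p(x)\in K[x]$ of degree $n$ is multiplicatively symmetric if $x^np(x^{ -1})=p(x)$, and additively symmetric if $p(x)=(-1)^np(-x)$. The displayed identity is an identity of Laurent polynomials in $\sqrt{x}$. -}

module Defs where

open import Algebra.Apartness.Bundles using (HeytingField)
open import Algebra.Bundles.Raw using (RawRing)
import Algebra.Definitions.RawSemiring as RawSemiringDefinitions
open import Data.Bool.Base using (if_then_else_)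
open import Data.Integer.Base as ℤ using (ℤ)
import Data.Integer.Properties as ℤ
open import Data.List.Base using (List; []; _∷_; _++_; map; cartesianProductWith; foldr)
open import Data.Nat.Base as ℕ using (ℕ)
import Data.Nat.Properties as ℕ
open import Data.Product.Base using (_×_; _,_; map₂)
open import Level using (_⊔_)
open import Relation.Binary.Definitions using (DecidableEquality)
open import Relation.Nullary.Decidable.Core using (does)

module Polynomials {c ℓ₁ ℓ₂} (K : HeytingField c ℓ₁ ℓ₂) where

  private module K = HeytingField K

  -- The monoid algebra K[E] of a monoid E of exponents.  An element is a finite
  -- formal sum of terms (e , a), read a·Xᵉ.  An exponent may occur repeatedly
  -- and a coefficient may be zero, so equality is equality of all coefficients.
  module MonoidAlgebra {E : Set} (_∙_ : E → E → E) (ε : E) (_≟_ : DecidableEquality E) where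

    Carrier : Set c
    Carrier = List (E × K.Carrier)

    coeff : Carrier → E → K.Carrier
    coeff []            e = K.0#
    coeff ((d , a) ∷ f) e = (if does (d ≟ e) then a else K.0#) K.+ coeff f e

    rawRing : RawRing c ℓ₁
    rawRing = record
      { Carrier = Carrier
      ; _≈_     = λ f g → ∀ e → coeff f e K.≈ coeff g e
      ; _+_     = _++_
      ; _*_     = cartesianProductWith λ (d , a) (e , b) → (d ∙ e) , (a K.* b)
      ; -_      = map (map₂ λ a → K.- a)
      ; 0#      = []
      ; 1#      = (ε , K.1#) ∷ []
      }

    open RawRing rawRing public hiding (Carrier)
    open RawSemiringDefinitions rawSemiring public using (_^_)

    const : K.Carrier → Carrier
    const a = (ε , a) ∷ []

    X^ : E → Carrier
    X^ e = (e , K.1#) ∷ []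

    -- Substitution of y for the indeterminate of a polynomial.
    ⟦_⟧ : List (ℕ × K.Carrier) → Carrier → Carrier
    ⟦ p ⟧ y = foldr (λ (i , a) r → const a * y ^ i + r) 0# p

  module Poly    = MonoidAlgebra ℕ._+_ 0 ℕ._≟_
  module Laurent = MonoidAlgebra ℤ._+_ ℤ.0ℤ ℤ._≟_

  K[x] : Set c
  K[x] = Poly.Carrier

  HasDegree : ℕ → K[x] → Set (ℓ₁ ⊔ ℓ₂)
  HasDegree n p = (Poly.coeff p n K.# K.0#) × (∀ k → n ℕ.< k → Poly.coeff p k K.≈ K.0#)

  -- In the two symmetry conditions n is the degree of the polynomial.

  -- xⁿ p(x⁻¹) = p(x), in K[x, x⁻¹].
  MultiplicativelySymmetric : ℕ → K[x] → Set ℓ₁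
  MultiplicativelySymmetric n p = x ^ n * ⟦ p ⟧ x⁻¹ ≈ ⟦ p ⟧ x
    where
    open Laurent
    x x⁻¹ : Carrier
    x   = X^ ℤ.1ℤ
    x⁻¹ = X^ ℤ.-1ℤ

  -- p(x) = (-1)ⁿ p(-x), in K[x].
  AdditivelySymmetric : ℕ → K[x] → Set ℓ₁
  AdditivelySymmetric n p = p ≈ (- 1#) ^ n * ⟦ p ⟧ (- x)
    where
    open Poly
    x : Carrier
    x = X^ 1

  -- p(x) = x^(n/2) (q(√x) + q(1/√x) - q(0)), in the ring of Laurent polynomials
  -- in √x; thus x = √x · √x and x^(n/2) = (√x)ⁿ.
  SymmetrisationIdentity : ℕ → K[x] → K[x] → Set ℓ₁
  SymmetrisationIdentity n p q =
    ⟦ p ⟧ (√x * √x) ≈ √x ^ n * (⟦ q ⟧ √x + ⟦ q ⟧ 1/√x + - ⟦ q ⟧ 0#)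
    where
    open Laurent
    √x 1/√x : Carrier
    √x   = X^ ℤ.1ℤ
    1/√x = X^ ℤ.-1ℤ

{-# OPTIONS --safe #-}
module Submission where

-- Comparing coefficients of (√x)ᵉ, the identity says that the coefficient of
-- (√x)ⁿ⁺ᵐ in p(√x · √x) is the coefficient of x^|m| in q, for every integer m.
-- Hence q is determined by p, and p(√x · √x) is invariant under m ↦ - m, which is
-- multiplicative symmetry.  Conversely, q is the polynomial part of
-- (√x)⁻ⁿ p(√x · √x); it only has terms of degree ≡ n (mod 2), as only even powers
-- of √x occur in p(√x · √x), so it is additively symmetric.

open import Algebra.Apartness.Bundles using (HeytingField; HeytingCommutativeRing)
open import Algebra.Bundles using (CommutativeRing)
open import Algebra.Bundles.Raw using (RawMonoid)
import Algebra.Definitions.RawMonoid as RawMonoidDefinitions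
import Algebra.Properties.CommutativeSemigroup as CommutativeSemigroupProperties
import Algebra.Properties.Ring as RingProperties
import Algebra.Properties.Semiring.Exp as SemiringExp
open import Data.Bool.Base using (Bool; true; false; if_then_else_)
open import Data.Integer.Base as ℤ using (ℤ; +_; -[1+_]; ∣_∣)
import Data.Integer.DivMod as ℤ
import Data.Integer.Properties as ℤ
open import Data.Integer.Tactic.RingSolver using (solve-∀)
open import Data.List.Base using (List; []; _∷_; _++_; map)
open import Data.Nat.Base as ℕ using (ℕ; zero; suc)
import Data.Nat.Properties as ℕ
open import Data.Product.Base using (_×_; _,_; ∃-syntax; map₂)
open import Data.Sum.Base using (_⊎_; inj₁; inj₂)
open import Function.Bundles using (_⇔_; mk⇔; Equivalence)
open import Relation.Binary.Definitions using (DecidableEquality)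
open import Relation.Binary.PropositionalEquality as ≡ using (_≡_)
import Relation.Binary.Reasoning.Setoid as SetoidReasoning
open import Relation.Nullary.Decidable using (Dec; yes; no; does; does-⇔; dec-false)
open import Relation.Nullary.Negation using (¬_; contradiction)
open import Defs

-- Parity of integers

integer-parity : ∀ e → ∃[ j ] (e ≡ j ℤ.* + 2 ⊎ e ≡ + 1 ℤ.+ j ℤ.* + 2)
integer-parity e with e ℤ.%ℕ 2 | ℤ.n%ℕd<d e 2 | ℤ.a≡a%ℕn+[a/ℕn]*n e 2
... | 0 | _ | e≡ = e ℤ./ℕ 2 , inj₁ (≡.trans e≡ (ℤ.+-identityˡ _))
... | 1 | _ | e≡ = e ℤ./ℕ 2 , inj₂ e≡
... | suc (suc _) | ℕ.s≤s (ℕ.s≤s ()) | _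

-- Otherwise (i - j) * 2 would be 1. Absolute values carry this to the natural numbers, where no
-- double is 1.
integer-even≢odd : ∀ i j → ¬ (i ℤ.* + 2 ≡ + 1 ℤ.+ j ℤ.* + 2)
integer-even≢odd i j eq = m*2≢1 ∣ i ℤ.- j ∣ (≡.trans (≡.sym (ℤ.abs-* (i ℤ.- j) (+ 2))) (≡.cong ∣_∣ difference))
  where
  m*2≢1 : ∀ m → ¬ (m ℕ.* 2 ≡ 1)
  m*2≢1 zero    ()
  m*2≢1 (suc m) ()

  distrib : ∀ i j → (i ℤ.- j) ℤ.* + 2 ≡ i ℤ.* + 2 ℤ.- j ℤ.* + 2
  distrib = solve-∀

  cancel : ∀ j → + 1 ℤ.+ j ℤ.* + 2 ℤ.- j ℤ.* + 2 ≡ + 1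
  cancel = solve-∀

  difference : (i ℤ.- j) ℤ.* + 2 ≡ + 1
  difference = ≡.trans (distrib i j) (≡.trans (≡.cong (ℤ._- j ℤ.* + 2) eq) (cancel j))

module _ {c ℓ₁ ℓ₂} (K : HeytingField c ℓ₁ ℓ₂) where

  open Polynomials K

  private
    module K = HeytingField K

    K-ring : CommutativeRing c ℓ₁
    K-ring = HeytingCommutativeRing.commutativeRing K.heytingCommutativeRing

    module KR = CommutativeRing K-ring

  open RingProperties KR.ring using (-0#≈0#; -‿+-comm; -‿distribˡ-*; -1*x≈-x; -‿involutive)
  open CommutativeSemigroupProperties KR.*-commutativeSemigroup using (x∙yz≈y∙xz)
  open CommutativeSemigroupProperties KR.+-commutativeSemigroup using ()
    renaming (interchange to +-interchange)
  open SemiringExp KR.semiring using (_^_; ^-congˡ; ^-congʳ; ^-homo-*; ^-assocʳ)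
  open SetoidReasoning KR.setoid

  -- Powers of 1 and -1, and apartness

  1^n≈1 : ∀ n → K.1# ^ n K.≈ K.1#
  1^n≈1 zero    = K.refl
  1^n≈1 (suc n) = K.trans (K.*-identityˡ _) (1^n≈1 n)

  [-1]^[n*2]≈1 : ∀ n → (K.- K.1#) ^ (n ℕ.* 2) K.≈ K.1#
  [-1]^[n*2]≈1 n = begin
    (K.- K.1#) ^ (n ℕ.* 2)  ≈⟨ ^-congʳ (K.- K.1#) (ℕ.*-comm n 2) ⟩
    (K.- K.1#) ^ (2 ℕ.* n)  ≈⟨ ^-assocʳ (K.- K.1#) 2 n ⟨
    ((K.- K.1#) ^ 2) ^ n    ≈⟨ ^-congˡ n [-1]^2≈1 ⟩
    K.1# ^ n                ≈⟨ 1^n≈1 n ⟩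
    K.1#                    ∎
    where
    [-1]^2≈1 : (K.- K.1#) ^ 2 K.≈ K.1#
    [-1]^2≈1 = K.trans (-1*x≈-x _) (K.trans (K.-‿cong (K.*-identityʳ _)) (-‿involutive K.1#))

  #-respˡ : ∀ {a b d} → a K.≈ b → a K.# d → b K.# d
  #-respˡ {a} {b} a≈b a#d with K.#-cotrans a#d b
  ... | inj₁ a#b = contradiction a#b (K.#-irrefl a≈b)
  ... | inj₂ b#d = b#d

  -- Indicators and linear functionals

  𝟙 : Bool → K.Carrier
  𝟙 b = if b then K.1# else K.0#

  -- This is how exponents are reindexed under a functional: the equation in an indicator is solved
  -- for another exponent.
  𝟙-cong : ∀ {A B : Set} (a? : Dec A) (b? : Dec B) → A ⇔ B → 𝟙 (does a?) K.≈ 𝟙 (does b?)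
  𝟙-cong a? b? A⇔B = K.reflexive (≡.cong 𝟙 (does-⇔ A⇔B a? b?))

  -- The linear functional on K[E] with the value w e at Xᵉ.
  ⟨_∣_⟩ : {E : Set} → List (E × K.Carrier) → (E → K.Carrier) → K.Carrier
  ⟨ []          ∣ w ⟩ = K.0#
  ⟨ (e , a) ∷ f ∣ w ⟩ = a K.* w e K.+ ⟨ f ∣ w ⟩

  module _ {E : Set} where

    ⟨∣⟩-cong : ∀ (f : List (E × K.Carrier)) {v w} → (∀ e → v e K.≈ w e) → ⟨ f ∣ v ⟩ K.≈ ⟨ f ∣ w ⟩
    ⟨∣⟩-cong []            v≈w = K.refl
    ⟨∣⟩-cong ((e , a) ∷ f) v≈w = K.+-cong (K.*-congˡ (v≈w e)) (⟨∣⟩-cong f v≈w)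

    ⟨∣0⟩ : ∀ (f : List (E × K.Carrier)) → ⟨ f ∣ (λ _ → K.0#) ⟩ K.≈ K.0#
    ⟨∣0⟩ []            = K.refl
    ⟨∣0⟩ ((e , a) ∷ f) = K.trans (K.+-cong (K.zeroʳ a) (⟨∣0⟩ f)) (K.+-identityˡ _)

    ⟨∣⟩-* : ∀ s (f : List (E × K.Carrier)) w → ⟨ f ∣ (λ e → s K.* w e) ⟩ K.≈ s K.* ⟨ f ∣ w ⟩
    ⟨∣⟩-* s []            w = K.sym (K.zeroʳ s)
    ⟨∣⟩-* s ((e , a) ∷ f) w =
      K.trans (K.+-cong (x∙yz≈y∙xz a s (w e)) (⟨∣⟩-* s f w)) (K.sym (K.distribˡ s _ _))

    ⟨∣⟩-+ : ∀ (f : List (E × K.Carrier)) v w →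
            ⟨ f ∣ (λ e → v e K.+ w e) ⟩ K.≈ ⟨ f ∣ v ⟩ K.+ ⟨ f ∣ w ⟩
    ⟨∣⟩-+ []            v w = K.sym (K.+-identityˡ _)
    ⟨∣⟩-+ ((e , a) ∷ f) v w =
      K.trans (K.+-cong (K.distribˡ a _ _) (⟨∣⟩-+ f v w)) (+-interchange _ _ _ _)

    ⟨∣⟩-neg : ∀ (f : List (E × K.Carrier)) w → ⟨ f ∣ (λ e → K.- w e) ⟩ K.≈ K.- ⟨ f ∣ w ⟩
    ⟨∣⟩-neg f w = begin
      ⟨ f ∣ (λ e → K.- w e) ⟩              ≈⟨ ⟨∣⟩-cong f (λ e → K.sym (-1*x≈-x (w e))) ⟩
      ⟨ f ∣ (λ e → (K.- K.1#) K.* w e) ⟩   ≈⟨ ⟨∣⟩-* (K.- K.1#) f w ⟩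
      (K.- K.1#) K.* ⟨ f ∣ w ⟩             ≈⟨ -1*x≈-x _ ⟩
      K.- ⟨ f ∣ w ⟩                        ∎

    ⟨++∣⟩ : ∀ (f g : List (E × K.Carrier)) w → ⟨ f ++ g ∣ w ⟩ K.≈ ⟨ f ∣ w ⟩ K.+ ⟨ g ∣ w ⟩
    ⟨++∣⟩ []            g w = K.sym (K.+-identityˡ _)
    ⟨++∣⟩ ((e , a) ∷ f) g w = K.trans (K.+-congˡ (⟨++∣⟩ f g w)) (K.sym (K.+-assoc _ _ _))

    ⟨-∣⟩ : ∀ (f : List (E × K.Carrier)) w → ⟨ map (map₂ λ a → K.- a) f ∣ w ⟩ K.≈ K.- ⟨ f ∣ w ⟩
    ⟨-∣⟩ []            w = K.sym -0#≈0#
    ⟨-∣⟩ ((e , a) ∷ f) w =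
      K.trans (K.+-cong (K.sym (-‿distribˡ-* a (w e))) (⟨-∣⟩ f w)) (-‿+-comm _ _)

  -- Functionals on products with monomials and on substitutions

  module MonoidAlgebraProperties
    {E : Set} (_∙_ : E → E → E) (ε : E) (_≟_ : DecidableEquality E)
    (identityˡ : ∀ e → ε ∙ e ≡ e) where

    private
      module A = MonoidAlgebra _∙_ ε _≟_

      E-rawMonoid : RawMonoid _ _
      E-rawMonoid = record { _≈_ = _≡_ ; _∙_ = _∙_ ; ε = ε }

    open RawMonoidDefinitions E-rawMonoid public using () renaming (_×_ to _·_)

    -- Functionals pass through sums, products with monomials and substitutions, so viewing a
    -- coefficient as a functional makes it computable without collecting the terms of a formal sum.
    coeff-as-⟨∣⟩ : ∀ f e → A.coeff f e K.≈ ⟨ f ∣ (λ d → 𝟙 (does (d ≟ e))) ⟩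
    coeff-as-⟨∣⟩ []            e = K.refl
    coeff-as-⟨∣⟩ ((d , a) ∷ f) e = K.+-cong (term (does (d ≟ e))) (coeff-as-⟨∣⟩ f e)
      where
      term : ∀ b → (if b then a else K.0#) K.≈ a K.* 𝟙 b
      term true  = K.sym (K.*-identityʳ a)
      term false = K.sym (K.zeroʳ a)

    -- The coefficient is arbitrary so that constants, -1, -x and √x · √x are all monomials by
    -- computation.
    monomial : E → K.Carrier → A.Carrier
    monomial d u = (d , u) ∷ []

    monomial-^ : ∀ d u n → monomial d u A.^ n ≡ monomial (n · d) (u ^ n)
    monomial-^ d u zero    = ≡.refl
    monomial-^ d u (suc n) = ≡.cong (monomial d u A.*_) (monomial-^ d u n)

    ⟨monomial*∣⟩ : ∀ d u f w → ⟨ monomial d u A.* f ∣ w ⟩ K.≈ u K.* ⟨ f ∣ (λ e → w (d ∙ e)) ⟩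
    ⟨monomial*∣⟩ d u []            w = K.sym (K.zeroʳ u)
    ⟨monomial*∣⟩ d u ((e , a) ∷ f) w =
      K.trans (K.+-cong (K.*-assoc u a _) (⟨monomial*∣⟩ d u f w)) (K.sym (K.distribˡ u _ _))

    ⟨monomial^*∣⟩ : ∀ d u n f w →
      ⟨ monomial d u A.^ n A.* f ∣ w ⟩ K.≈ u ^ n K.* ⟨ f ∣ (λ e → w ((n · d) ∙ e)) ⟩
    ⟨monomial^*∣⟩ d u n f w rewrite monomial-^ d u n = ⟨monomial*∣⟩ (n · d) (u ^ n) f w

    -- Substitution is linear in `p`, so only the values of `w` on powers of `y` matter. Here `y`
    -- need not be a monomial: q(0) arises by substituting `0#`, the empty sum.
    ⟨⟦⟧∣⟩ : ∀ p y w → ⟨ A.⟦ p ⟧ y ∣ w ⟩ K.≈ ⟨ p ∣ (λ i → ⟨ y A.^ i ∣ w ⟩) ⟩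
    ⟨⟦⟧∣⟩ []            y w = K.refl
    ⟨⟦⟧∣⟩ ((i , a) ∷ p) y w = begin
      ⟨ A.const a A.* y A.^ i ++ A.⟦ p ⟧ y ∣ w ⟩
        ≈⟨ ⟨++∣⟩ (A.const a A.* y A.^ i) (A.⟦ p ⟧ y) w ⟩
      ⟨ A.const a A.* y A.^ i ∣ w ⟩ K.+ ⟨ A.⟦ p ⟧ y ∣ w ⟩
        ≈⟨ K.+-cong (⟨monomial*∣⟩ ε a (y A.^ i) w) (⟨⟦⟧∣⟩ p y w) ⟩
      a K.* ⟨ y A.^ i ∣ (λ e → w (ε ∙ e)) ⟩ K.+ ⟨ p ∣ (λ i → ⟨ y A.^ i ∣ w ⟩) ⟩
        ≈⟨ K.+-congʳ (K.*-congˡ (⟨∣⟩-cong (y A.^ i) λ e → K.reflexive (≡.cong w (identityˡ e)))) ⟩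
      a K.* ⟨ y A.^ i ∣ w ⟩ K.+ ⟨ p ∣ (λ i → ⟨ y A.^ i ∣ w ⟩) ⟩ ∎

    ⟨⟦⟧monomial∣⟩ : ∀ p d u w →
      ⟨ A.⟦ p ⟧ (monomial d u) ∣ w ⟩ K.≈ ⟨ p ∣ (λ i → u ^ i K.* w (i · d)) ⟩
    ⟨⟦⟧monomial∣⟩ p d u w = K.trans (⟨⟦⟧∣⟩ p (monomial d u) w) (⟨∣⟩-cong p λ i →
      K.trans (K.reflexive (≡.cong (λ f → ⟨ f ∣ w ⟩) (monomial-^ d u i))) (K.+-identityʳ _))

  -- Coefficients of p(x) and p(x²) at integer exponents

  module PolyProps    = MonoidAlgebraProperties ℕ._+_ 0 ℕ._≟_ ℕ.+-identityˡ
  module LaurentProps = MonoidAlgebraProperties ℤ._+_ ℤ.0ℤ ℤ._≟_ ℤ.+-identityˡ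

  open PolyProps using (coeff-as-⟨∣⟩)

  n·d≡n*d : ∀ n d → n PolyProps.· d ≡ n ℕ.* d
  n·d≡n*d zero    d = ≡.refl
  n·d≡n*d (suc n) d = ≡.cong (d ℕ.+_) (n·d≡n*d n d)

  n·i≡+n*i : ∀ n i → n LaurentProps.· i ≡ + n ℤ.* i
  n·i≡+n*i zero    i = ≡.sym (ℤ.*-zeroˡ i)
  n·i≡+n*i (suc n) i = ≡.trans (≡.cong (λ j → i ℤ.+ j) (n·i≡+n*i n i)) (≡.sym (ℤ.suc-* (+ n) i))

  -- Extending the coefficients by zero to negative exponents lets the reflection of e to n - e act
  -- on all integers.
  coeffᶻ : K[x] → ℤ → K.Carrier
  coeffᶻ p e = ⟨ p ∣ (λ i → 𝟙 (does (+ i ℤ.≟ e))) ⟩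

  -- The coefficient of xᵉ in p(x²).
  coeff² : K[x] → ℤ → K.Carrier
  coeff² p e = ⟨ p ∣ (λ i → 𝟙 (does (+ i ℤ.* + 2 ℤ.≟ e))) ⟩

  coeffᶻ-+ : ∀ p k → coeffᶻ p (+ k) K.≈ Poly.coeff p k
  coeffᶻ-+ p k = K.sym (coeff-as-⟨∣⟩ p k)

  coeff²-even : ∀ p j → coeff² p (j ℤ.* + 2) K.≈ coeffᶻ p j
  coeff²-even p j = ⟨∣⟩-cong p λ i → 𝟙-cong (+ i ℤ.* + 2 ℤ.≟ j ℤ.* + 2) (+ i ℤ.≟ j)
    (mk⇔ (ℤ.*-cancelʳ-≡ (+ i) j (+ 2)) (≡.cong (ℤ._* + 2)))

  coeff²-odd : ∀ p j → coeff² p (+ 1 ℤ.+ j ℤ.* + 2) K.≈ K.0#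
  coeff²-odd p j = K.trans
    (⟨∣⟩-cong p λ i → K.reflexive (≡.cong 𝟙 (dec-false (+ i ℤ.* + 2 ℤ.≟ _) (integer-even≢odd (+ i) j))))
    (⟨∣0⟩ p)

  -- Coefficients of both sides of the two identities

  module _ where
    open Laurent hiding (_^_)
    open LaurentProps hiding (coeff-as-⟨∣⟩)

    -- The coefficient `u` is 1 only up to `≈` because √x · √x has coefficient 1 * 1. The map `φ`
    -- gives the exponents in the form wanted afterwards.
    ⟨⟦⟧unit∣⟩ : ∀ p d {u} (φ : ℕ → ℤ) w → u K.≈ K.1# → (∀ i → + i ℤ.* d ≡ φ i) →
               ⟨ ⟦ p ⟧ (monomial d u) ∣ w ⟩ K.≈ ⟨ p ∣ (λ i → w (φ i)) ⟩
    ⟨⟦⟧unit∣⟩ p d {u} φ w u≈1 eq = K.trans (⟨⟦⟧monomial∣⟩ p d u w) (⟨∣⟩-cong p λ i → begin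
      u ^ i K.* w (i · d)        ≈⟨ K.*-congʳ (K.trans (^-congˡ i u≈1) (1^n≈1 i)) ⟩
      K.1# K.* w (i · d)         ≈⟨ K.*-identityˡ _ ⟩
      w (i · d)                  ≡⟨ ≡.cong w (≡.trans (n·i≡+n*i i d) (eq i)) ⟩
      w (φ i)                    ∎)

    ⟨x^n*∣⟩ : ∀ n f w → ⟨ X^ ℤ.1ℤ Laurent.^ n * f ∣ w ⟩ K.≈ ⟨ f ∣ (λ e → w (+ n ℤ.+ e)) ⟩
    ⟨x^n*∣⟩ n f w = begin
      ⟨ X^ ℤ.1ℤ Laurent.^ n * f ∣ w ⟩
        ≈⟨ ⟨monomial^*∣⟩ ℤ.1ℤ K.1# n f w ⟩
      K.1# ^ n K.* ⟨ f ∣ (λ e → w (n · ℤ.1ℤ ℤ.+ e)) ⟩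
        ≈⟨ K.*-congʳ (1^n≈1 n) ⟩
      K.1# K.* ⟨ f ∣ (λ e → w (n · ℤ.1ℤ ℤ.+ e)) ⟩
        ≈⟨ K.*-identityˡ _ ⟩
      ⟨ f ∣ (λ e → w (n · ℤ.1ℤ ℤ.+ e)) ⟩
        ≈⟨ ⟨∣⟩-cong f (λ e → K.reflexive (≡.cong (λ d → w (d ℤ.+ e)) n·1≡n)) ⟩
      ⟨ f ∣ (λ e → w (+ n ℤ.+ e)) ⟩ ∎
      where
      n·1≡n : n · ℤ.1ℤ ≡ + n
      n·1≡n = ≡.trans (n·i≡+n*i n ℤ.1ℤ) (ℤ.*-identityʳ (+ n))

    n*-1≡-n : ∀ n → + n ℤ.* ℤ.-1ℤ ≡ ℤ.- + n
    n*-1≡-n n = ≡.trans (ℤ.*-comm (+ n) ℤ.-1ℤ) (ℤ.-1*i≡-i (+ n))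

    coeff-⟦p⟧x : ∀ p e → coeff (⟦ p ⟧ (X^ ℤ.1ℤ)) e K.≈ coeffᶻ p e
    coeff-⟦p⟧x p e = K.trans (LaurentProps.coeff-as-⟨∣⟩ (⟦ p ⟧ (X^ ℤ.1ℤ)) e)
      (⟨⟦⟧unit∣⟩ p ℤ.1ℤ +_ _ K.refl (λ i → ℤ.*-identityʳ (+ i)))

    coeff-⟦p⟧x² : ∀ p e → coeff (⟦ p ⟧ (X^ ℤ.1ℤ * X^ ℤ.1ℤ)) e K.≈ coeff² p e
    coeff-⟦p⟧x² p e = K.trans (LaurentProps.coeff-as-⟨∣⟩ (⟦ p ⟧ (X^ ℤ.1ℤ * X^ ℤ.1ℤ)) e)
      (⟨⟦⟧unit∣⟩ p (+ 2) (λ i → + i ℤ.* + 2) _ (K.*-identityˡ K.1#) (λ _ → ≡.refl))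

    -- A term of `p` of degree i lands at the exponent n - i, and n - i = e exactly when i = n - e.
    coeff-reciprocal : ∀ n p e →
      coeff (X^ ℤ.1ℤ Laurent.^ n * ⟦ p ⟧ (X^ ℤ.-1ℤ)) e K.≈ coeffᶻ p (+ n ℤ.- e)
    coeff-reciprocal n p e = begin
      coeff (X^ ℤ.1ℤ Laurent.^ n * ⟦ p ⟧ (X^ ℤ.-1ℤ)) e
        ≈⟨ LaurentProps.coeff-as-⟨∣⟩ (X^ ℤ.1ℤ Laurent.^ n * ⟦ p ⟧ (X^ ℤ.-1ℤ)) e ⟩
      ⟨ X^ ℤ.1ℤ Laurent.^ n * ⟦ p ⟧ (X^ ℤ.-1ℤ) ∣ (λ d → 𝟙 (does (d ℤ.≟ e))) ⟩
        ≈⟨ ⟨x^n*∣⟩ n (⟦ p ⟧ (X^ ℤ.-1ℤ)) _ ⟩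
      ⟨ ⟦ p ⟧ (X^ ℤ.-1ℤ) ∣ (λ d → 𝟙 (does (+ n ℤ.+ d ℤ.≟ e))) ⟩
        ≈⟨ ⟨⟦⟧unit∣⟩ p ℤ.-1ℤ (λ i → ℤ.- + i) _ K.refl n*-1≡-n ⟩
      ⟨ p ∣ (λ i → 𝟙 (does (+ n ℤ.- + i ℤ.≟ e))) ⟩
        ≈⟨ ⟨∣⟩-cong p (λ i → 𝟙-cong (+ n ℤ.- + i ℤ.≟ e) (+ i ℤ.≟ + n ℤ.- e)
             (mk⇔ (λ { ≡.refl → swap (+ n) (+ i) })
                  (λ { eq → ≡.trans (≡.cong (λ j → + n ℤ.- j) eq) (≡.sym (swap (+ n) e)) }))) ⟩
      coeffᶻ p (+ n ℤ.- e) ∎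
      where
      swap : ∀ a b → b ≡ a ℤ.- (a ℤ.- b)
      swap = solve-∀

    -- The i-th terms of q(x), q(1/x) and q(0) contribute to xᵐ only if i = |m|;
    -- subtracting q(0) corrects the double count at i = 0.
    indicator-∣∣ : ∀ i m →
      𝟙 (does (+ i ℤ.≟ m)) K.+ 𝟙 (does (ℤ.- + i ℤ.≟ m)) K.+
        K.- ⟨ 0# Laurent.^ i ∣ (λ d → 𝟙 (does (d ℤ.≟ m))) ⟩
      K.≈ 𝟙 (does (i ℕ.≟ ∣ m ∣))
    indicator-∣∣ zero m = begin
      -- `0# ^ 0` is `1#`, so at i = 0 the third term cancels one of two equal indicators.
      w K.+ w K.+ K.- (K.1# K.* w K.+ K.0#)  ≈⟨ K.+-congˡ (K.-‿cong (K.trans (K.+-identityʳ _) (K.*-identityˡ w))) ⟩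
      w K.+ w K.+ K.- w                      ≈⟨ K.+-assoc w w (K.- w) ⟩
      w K.+ (w K.+ K.- w)                    ≈⟨ K.+-congˡ (K.-‿inverseʳ w) ⟩
      w K.+ K.0#                             ≈⟨ K.+-identityʳ w ⟩
      w                                      ≈⟨ 𝟙-cong (+ 0 ℤ.≟ m) (0 ℕ.≟ ∣ m ∣)
                                                  (mk⇔ (≡.cong ∣_∣) (λ eq → ≡.sym (ℤ.∣i∣≡0⇒i≡0 (≡.sym eq)))) ⟩
      𝟙 (does (0 ℕ.≟ ∣ m ∣))                 ∎
      where
      w : K.Carrier
      w = 𝟙 (does (+ 0 ℤ.≟ m))
    -- A positive power of `0#` is the empty sum, so the third term vanishes; the sign of `m` rules
    -- out at least one of the other two.
    indicator-∣∣ (suc i) m = K.trans (K.+-congˡ -0#≈0#) (K.trans (K.+-identityʳ _) (nonzero m))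
      where
      nonzero : ∀ m → 𝟙 (does (+ suc i ℤ.≟ m)) K.+ 𝟙 (does (-[1+ i ] ℤ.≟ m)) K.≈ 𝟙 (does (suc i ℕ.≟ ∣ m ∣))
      nonzero (+ zero)    = K.+-identityˡ _
      nonzero (+ (suc k)) = K.+-identityʳ _
      nonzero (-[1+ k ])  = K.+-identityˡ _

    -- The factor (√x)ⁿ moves the exponent e to m = e - n. The functional then splits over the three
    -- summands, and each part becomes a functional on `q`.
    coeff-symmetrisation : ∀ n q e →
      coeff (X^ ℤ.1ℤ Laurent.^ n * (⟦ q ⟧ (X^ ℤ.1ℤ) + ⟦ q ⟧ (X^ ℤ.-1ℤ) + - ⟦ q ⟧ 0#)) e
      K.≈ Poly.coeff q ∣ e ℤ.- + n ∣
    coeff-symmetrisation n q e = begin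
      coeff (X^ ℤ.1ℤ Laurent.^ n * (q₁ + q₂ + - q₀)) e
        ≈⟨ LaurentProps.coeff-as-⟨∣⟩ (X^ ℤ.1ℤ Laurent.^ n * (q₁ + q₂ + - q₀)) e ⟩
      ⟨ X^ ℤ.1ℤ Laurent.^ n * (q₁ + q₂ + - q₀) ∣ (λ d → 𝟙 (does (d ℤ.≟ e))) ⟩
        ≈⟨ ⟨x^n*∣⟩ n (q₁ + q₂ + - q₀) _ ⟩
      ⟨ q₁ + q₂ + - q₀ ∣ (λ d → 𝟙 (does (+ n ℤ.+ d ℤ.≟ e))) ⟩
        ≈⟨ ⟨∣⟩-cong (q₁ + q₂ + - q₀) (λ d → 𝟙-cong (+ n ℤ.+ d ℤ.≟ e) (d ℤ.≟ e ℤ.- + n)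
             (mk⇔ (λ { ≡.refl → cancelˡ (+ n) d }) (λ { ≡.refl → cancelʳ (+ n) e }))) ⟩
      ⟨ q₁ + q₂ + - q₀ ∣ w ⟩
        ≈⟨ ⟨++∣⟩ (q₁ + q₂) (- q₀) w ⟩
      ⟨ q₁ + q₂ ∣ w ⟩ K.+ ⟨ - q₀ ∣ w ⟩
        ≈⟨ K.+-cong (⟨++∣⟩ q₁ q₂ w) (⟨-∣⟩ q₀ w) ⟩
      ⟨ q₁ ∣ w ⟩ K.+ ⟨ q₂ ∣ w ⟩ K.+ K.- ⟨ q₀ ∣ w ⟩
        ≈⟨ K.+-cong (K.+-cong (⟨⟦⟧unit∣⟩ q ℤ.1ℤ +_ w K.refl (λ i → ℤ.*-identityʳ (+ i)))
                              (⟨⟦⟧unit∣⟩ q ℤ.-1ℤ (λ i → ℤ.- + i) w K.refl n*-1≡-n))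
                    (K.-‿cong (⟨⟦⟧∣⟩ q 0# w)) ⟩
      ⟨ q ∣ w₁ ⟩ K.+ ⟨ q ∣ w₂ ⟩ K.+ K.- ⟨ q ∣ w₀ ⟩
        -- Recombining into a single functional on `q` allows the cancellation to be done one
        -- exponent at a time.
        ≈⟨ K.+-cong (⟨∣⟩-+ q w₁ w₂) (⟨∣⟩-neg q w₀) ⟨
      ⟨ q ∣ (λ i → w₁ i K.+ w₂ i) ⟩ K.+ ⟨ q ∣ (λ i → K.- w₀ i) ⟩
        ≈⟨ ⟨∣⟩-+ q (λ i → w₁ i K.+ w₂ i) (λ i → K.- w₀ i) ⟨
      ⟨ q ∣ (λ i → w₁ i K.+ w₂ i K.+ K.- w₀ i) ⟩
        ≈⟨ ⟨∣⟩-cong q (λ i → indicator-∣∣ i (e ℤ.- + n)) ⟩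
      ⟨ q ∣ (λ i → 𝟙 (does (i ℕ.≟ ∣ e ℤ.- + n ∣))) ⟩
        ≈⟨ coeff-as-⟨∣⟩ q ∣ e ℤ.- + n ∣ ⟨
      Poly.coeff q ∣ e ℤ.- + n ∣ ∎
      where
      q₁ q₂ q₀ : Carrier
      q₁ = ⟦ q ⟧ (X^ ℤ.1ℤ)
      q₂ = ⟦ q ⟧ (X^ ℤ.-1ℤ)
      q₀ = ⟦ q ⟧ 0#

      w : ℤ → K.Carrier
      w d = 𝟙 (does (d ℤ.≟ e ℤ.- + n))

      w₁ w₂ w₀ : ℕ → K.Carrier
      w₁ i = w (+ i)
      w₂ i = w (ℤ.- + i)
      w₀ i = ⟨ 0# Laurent.^ i ∣ w ⟩

      cancelˡ : ∀ a b → b ≡ a ℤ.+ b ℤ.- a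
      cancelˡ = solve-∀

      cancelʳ : ∀ a b → a ℤ.+ (b ℤ.- a) ≡ b
      cancelʳ = solve-∀

  -- The two conditions in terms of coefficients

  multiplicativelySymmetric⇔ : ∀ n p →
    MultiplicativelySymmetric n p ⇔ (∀ e → coeffᶻ p (+ n ℤ.- e) K.≈ coeffᶻ p e)
  multiplicativelySymmetric⇔ n p = mk⇔
    (λ ms e → K.trans (K.sym (coeff-reciprocal n p e)) (K.trans (ms e) (coeff-⟦p⟧x p e)))
    (λ sym e → K.trans (coeff-reciprocal n p e) (K.trans (sym e) (K.sym (coeff-⟦p⟧x p e))))

  symmetrisationIdentity⇔ : ∀ n p q →
    SymmetrisationIdentity n p q ⇔ (∀ e → coeff² p e K.≈ Poly.coeff q ∣ e ℤ.- + n ∣)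
  symmetrisationIdentity⇔ n p q = mk⇔
    (λ si e → K.trans (K.sym (coeff-⟦p⟧x² p e)) (K.trans (si e) (coeff-symmetrisation n q e)))
    (λ eq e → K.trans (coeff-⟦p⟧x² p e) (K.trans (eq e) (K.sym (coeff-symmetrisation n q e))))

  -- Doubling the exponents turns the symmetry of `p` about n/2 into a symmetry of p(x²) about n.
  multiplicativelySymmetric⇒coeff²-reflect : ∀ n p → MultiplicativelySymmetric n p →
    ∀ e → coeff² p (+ n ℤ.* + 2 ℤ.- e) K.≈ coeff² p e
  multiplicativelySymmetric⇒coeff²-reflect n p ms e with integer-parity e
  ... | j , inj₁ ≡.refl = begin
    coeff² p (+ n ℤ.* + 2 ℤ.- j ℤ.* + 2)  ≡⟨ ≡.cong (coeff² p) (distrib (+ n) j) ⟩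
    coeff² p ((+ n ℤ.- j) ℤ.* + 2)        ≈⟨ coeff²-even p (+ n ℤ.- j) ⟩
    coeffᶻ p (+ n ℤ.- j)                  ≈⟨ Equivalence.to (multiplicativelySymmetric⇔ n p) ms j ⟩
    coeffᶻ p j                            ≈⟨ coeff²-even p j ⟨
    coeff² p (j ℤ.* + 2)                  ∎
    where
    distrib : ∀ a j → a ℤ.* + 2 ℤ.- j ℤ.* + 2 ≡ (a ℤ.- j) ℤ.* + 2
    distrib = solve-∀
  -- The reflection preserves parity, and both coefficients at odd exponents are zero.
  ... | j , inj₂ ≡.refl = begin
    coeff² p (+ n ℤ.* + 2 ℤ.- (+ 1 ℤ.+ j ℤ.* + 2))  ≡⟨ ≡.cong (coeff² p) (distrib (+ n) j) ⟩
    coeff² p (+ 1 ℤ.+ (+ n ℤ.- j ℤ.- + 1) ℤ.* + 2)  ≈⟨ coeff²-odd p (+ n ℤ.- j ℤ.- + 1) ⟩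
    K.0#                                            ≈⟨ coeff²-odd p j ⟨
    coeff² p (+ 1 ℤ.+ j ℤ.* + 2)                    ∎
    where
    distrib : ∀ a j → a ℤ.* + 2 ℤ.- (+ 1 ℤ.+ j ℤ.* + 2) ≡ + 1 ℤ.+ (a ℤ.- j ℤ.- + 1) ℤ.* + 2
    distrib = solve-∀

  -- At the exponent 2e the identity gives the coefficient of `p` at e as that of `q` at |2e - n|,
  -- and replacing e by n - e only changes the sign of 2e - n.
  symmetrisationIdentity⇒multiplicativelySymmetric : ∀ n p q →
    SymmetrisationIdentity n p q → MultiplicativelySymmetric n p
  symmetrisationIdentity⇒multiplicativelySymmetric n p q si =
    Equivalence.from (multiplicativelySymmetric⇔ n p) λ e → begin
      coeffᶻ p (+ n ℤ.- e)
        ≈⟨ coeffᶻ-from-q (+ n ℤ.- e) ⟩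
      Poly.coeff q ∣ (+ n ℤ.- e) ℤ.* + 2 ℤ.- + n ∣
        ≡⟨ ≡.cong (Poly.coeff q) (≡.trans (≡.cong ∣_∣ (negate (+ n) e)) (ℤ.∣-i∣≡∣i∣ (e ℤ.* + 2 ℤ.- + n))) ⟩
      Poly.coeff q ∣ e ℤ.* + 2 ℤ.- + n ∣
        ≈⟨ coeffᶻ-from-q e ⟨
      coeffᶻ p e ∎
    where
    coeffᶻ-from-q : ∀ e → coeffᶻ p e K.≈ Poly.coeff q ∣ e ℤ.* + 2 ℤ.- + n ∣
    coeffᶻ-from-q e = K.trans (K.sym (coeff²-even p e))
      (Equivalence.to (symmetrisationIdentity⇔ n p q) si (e ℤ.* + 2))

    negate : ∀ a e → (a ℤ.- e) ℤ.* + 2 ℤ.- a ≡ ℤ.- (e ℤ.* + 2 ℤ.- a)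
    negate = solve-∀

  -- The identity is read at e = n + k, where |e - n| is k itself. The resulting value depends only
  -- on `n` and `p`, which gives uniqueness.
  symmetrisationIdentity⇒coeff : ∀ n p q → SymmetrisationIdentity n p q →
    ∀ k → Poly.coeff q k K.≈ coeff² p (+ n ℤ.+ + k)
  symmetrisationIdentity⇒coeff n p q si k = K.sym (K.trans
    (Equivalence.to (symmetrisationIdentity⇔ n p q) si (+ n ℤ.+ + k))
    (K.reflexive (≡.cong (λ m → Poly.coeff q ∣ m ∣) (cancel (+ n) (+ k)))))
    where
    cancel : ∀ a b → a ℤ.+ b ℤ.- a ≡ b
    cancel = solve-∀

  -- Construction of q from p

  polynomialPart : Laurent.Carrier → K[x]
  polynomialPart []                   = []
  polynomialPart ((+ k , a) ∷ f)      = (k , a) ∷ polynomialPart f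
  polynomialPart ((-[1+ k ] , a) ∷ f) = polynomialPart f

  coeff-polynomialPart : ∀ f k → Poly.coeff (polynomialPart f) k K.≈ Laurent.coeff f (+ k)
  coeff-polynomialPart []                   k = K.refl
  coeff-polynomialPart ((+ j , a) ∷ f)      k = K.+-congˡ (coeff-polynomialPart f k)
  coeff-polynomialPart ((-[1+ j ] , a) ∷ f) k =
    K.trans (coeff-polynomialPart f k) (K.sym (K.+-identityˡ _))

  -- The factor (√x)⁻ⁿ moves the centre of reflection from n to 0. For symmetric `p`, the polynomial
  -- part keeps one of each pair of mirrored terms and the central term once.
  desymmetrisation : ℕ → K[x] → K[x]
  desymmetrisation n p =
    polynomialPart (X^ (ℤ.- + n) * ⟦ p ⟧ (X^ ℤ.1ℤ * X^ ℤ.1ℤ))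
    where open Laurent

  module _ (n : ℕ) (p : K[x]) where

    private
      q : K[x]
      q = desymmetrisation n p

    coeff-desymmetrisation : ∀ k → Poly.coeff q k K.≈ coeff² p (+ n ℤ.+ + k)
    coeff-desymmetrisation k = begin
      Poly.coeff q k
        ≈⟨ coeff-polynomialPart (X^ (ℤ.- + n) * p²) k ⟩
      coeff (X^ (ℤ.- + n) * p²) (+ k)
        ≈⟨ LaurentProps.coeff-as-⟨∣⟩ (X^ (ℤ.- + n) * p²) (+ k) ⟩
      ⟨ X^ (ℤ.- + n) * p² ∣ (λ d → 𝟙 (does (d ℤ.≟ + k))) ⟩
        ≈⟨ K.trans (LaurentProps.⟨monomial*∣⟩ (ℤ.- + n) K.1# p² _) (K.*-identityˡ _) ⟩
      ⟨ p² ∣ (λ d → 𝟙 (does (ℤ.- + n ℤ.+ d ℤ.≟ + k))) ⟩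
        ≈⟨ ⟨∣⟩-cong p² (λ d → 𝟙-cong (ℤ.- + n ℤ.+ d ℤ.≟ + k) (d ℤ.≟ + n ℤ.+ + k)
             (mk⇔ (λ eq → ≡.trans (cancelˡ (+ n) d) (≡.cong (λ j → + n ℤ.+ j) eq))
                  (λ { ≡.refl → cancelʳ (+ n) (+ k) }))) ⟩
      ⟨ p² ∣ (λ d → 𝟙 (does (d ℤ.≟ + n ℤ.+ + k))) ⟩
        ≈⟨ LaurentProps.coeff-as-⟨∣⟩ p² (+ n ℤ.+ + k) ⟨
      coeff p² (+ n ℤ.+ + k)
        ≈⟨ coeff-⟦p⟧x² p (+ n ℤ.+ + k) ⟩
      coeff² p (+ n ℤ.+ + k) ∎
      where
      open Laurent
      p² : Carrier
      p² = ⟦ p ⟧ (X^ ℤ.1ℤ * X^ ℤ.1ℤ)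

      cancelˡ : ∀ a d → d ≡ a ℤ.+ (ℤ.- a ℤ.+ d)
      cancelˡ = solve-∀

      cancelʳ : ∀ a k → ℤ.- a ℤ.+ (a ℤ.+ k) ≡ k
      cancelʳ = solve-∀

    -- The coefficient of `q` at k is that of p(x²) at n + k. For k = n this is the leading
    -- coefficient of `p`; for k > n it is zero, because n + k is odd or its half exceeds n.
    desymmetrisation-hasDegree : HasDegree n p → HasDegree n q
    desymmetrisation-hasDegree (pₙ#0 , p>n≈0) = #-respˡ (K.sym leading) pₙ#0 , vanishing
      where
      double : ∀ a → a ℤ.+ a ≡ a ℤ.* + 2
      double = solve-∀

      leading : Poly.coeff q n K.≈ Poly.coeff p n
      leading = begin
        Poly.coeff q n          ≈⟨ coeff-desymmetrisation n ⟩
        coeff² p (+ n ℤ.+ + n)  ≡⟨ ≡.cong (coeff² p) (double (+ n)) ⟩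
        coeff² p (+ n ℤ.* + 2)  ≈⟨ coeff²-even p (+ n) ⟩
        coeffᶻ p (+ n)          ≈⟨ coeffᶻ-+ p n ⟩
        Poly.coeff p n          ∎

      coeffᶻ-vanishing : ∀ j → + n ℤ.< j → coeffᶻ p j K.≈ K.0#
      -- No negative integer exceeds `+ n`, so this clause is exhaustive.
      coeffᶻ-vanishing (+ j) (ℤ.+<+ n<j) = K.trans (coeffᶻ-+ p j) (p>n≈0 j n<j)

      vanishing : ∀ k → n ℕ.< k → Poly.coeff q k K.≈ K.0#
      vanishing k n<k with integer-parity (+ n ℤ.+ + k)
      ... | j , inj₁ n+k≡2j = begin
        Poly.coeff q k          ≈⟨ coeff-desymmetrisation k ⟩
        coeff² p (+ n ℤ.+ + k)  ≡⟨ ≡.cong (coeff² p) n+k≡2j ⟩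
        coeff² p (j ℤ.* + 2)    ≈⟨ coeff²-even p j ⟩
        -- From n < k follows 2n < n + k = 2j, hence n < j.
        coeffᶻ p j              ≈⟨ coeffᶻ-vanishing j (ℤ.*-cancelʳ-<-nonNeg (+ 2)
                                     (≡.subst₂ ℤ._<_ (double (+ n)) n+k≡2j
                                       (ℤ.+-monoʳ-< (+ n) (ℤ.+<+ n<k)))) ⟩
        K.0#                    ∎
      ... | j , inj₂ n+k≡1+2j = begin
        Poly.coeff q k                ≈⟨ coeff-desymmetrisation k ⟩
        coeff² p (+ n ℤ.+ + k)        ≡⟨ ≡.cong (coeff² p) n+k≡1+2j ⟩
        coeff² p (+ 1 ℤ.+ j ℤ.* + 2)  ≈⟨ coeff²-odd p j ⟩
        K.0#                          ∎

    -- The sign is 1 wherever the coefficient is nonzero.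
    desymmetrisation-sign : ∀ k → (K.- K.1#) ^ (n ℕ.+ k) K.* Poly.coeff q k K.≈ Poly.coeff q k
    desymmetrisation-sign k = begin
      (K.- K.1#) ^ (n ℕ.+ k) K.* Poly.coeff q k
        ≈⟨ K.*-congˡ (coeff-desymmetrisation k) ⟩
      (K.- K.1#) ^ (n ℕ.+ k) K.* coeff² p (+ (n ℕ.+ k))
        ≈⟨ ⟨∣⟩-* ((K.- K.1#) ^ (n ℕ.+ k)) p _ ⟨
      ⟨ p ∣ (λ i → (K.- K.1#) ^ (n ℕ.+ k) K.* 𝟙 (does (+ i ℤ.* + 2 ℤ.≟ + (n ℕ.+ k)))) ⟩
        ≈⟨ ⟨∣⟩-cong p (λ i → term (n ℕ.+ k) i) ⟩
      coeff² p (+ (n ℕ.+ k))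
        ≈⟨ coeff-desymmetrisation k ⟨
      Poly.coeff q k ∎
      where
      -- `m` stands for n + k, as a variable so that the equation m = 2i can be matched with
      -- `≡.refl`.
      term : ∀ m i → (K.- K.1#) ^ m K.* 𝟙 (does (+ i ℤ.* + 2 ℤ.≟ + m)) K.≈ 𝟙 (does (+ i ℤ.* + 2 ℤ.≟ + m))
      term m i with + i ℤ.* + 2 ℤ.≟ + m
      ... | no _  = K.zeroʳ _
      ... | yes 2i≡m with ℤ.+-injective (≡.trans (ℤ.pos-* i 2) 2i≡m)
      ...   | ≡.refl = K.trans (K.*-identityʳ _) ([-1]^[n*2]≈1 i)

    -- The coefficient of (-1)ⁿ q(-x) at k is that of `q` times (-1)ⁿ⁺ᵏ, a sign that
    -- `desymmetrisation-sign` removes.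
    desymmetrisation-additivelySymmetric : AdditivelySymmetric n q
    desymmetrisation-additivelySymmetric k = K.sym (begin
      coeff ((- 1#) Poly.^ n * ⟦ q ⟧ (- X^ 1)) k
        ≈⟨ coeff-as-⟨∣⟩ ((- 1#) Poly.^ n * ⟦ q ⟧ (- X^ 1)) k ⟩
      ⟨ (- 1#) Poly.^ n * ⟦ q ⟧ (- X^ 1) ∣ (λ i → 𝟙 (does (i ℕ.≟ k))) ⟩
        ≈⟨ PolyProps.⟨monomial^*∣⟩ 0 (K.- K.1#) n (⟦ q ⟧ (- X^ 1)) _ ⟩
      (K.- K.1#) ^ n K.* ⟨ ⟦ q ⟧ (- X^ 1) ∣ (λ i → 𝟙 (does (n PolyProps.· 0 ℕ.+ i ℕ.≟ k))) ⟩
        ≈⟨ K.*-congˡ (PolyProps.⟨⟦⟧monomial∣⟩ q 1 (K.- K.1#) _) ⟩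
      (K.- K.1#) ^ n K.*
        ⟨ q ∣ (λ i → (K.- K.1#) ^ i K.* 𝟙 (does (n PolyProps.· 0 ℕ.+ i PolyProps.· 1 ℕ.≟ k))) ⟩
        -- Under the indicator of i = k the sign (-1)ⁱ may be replaced by (-1)ᵏ, which is constant
        -- in i and can be taken out.
        ≈⟨ K.*-congˡ (⟨∣⟩-cong q term) ⟩
      (K.- K.1#) ^ n K.* ⟨ q ∣ (λ i → (K.- K.1#) ^ k K.* 𝟙 (does (i ℕ.≟ k))) ⟩
        ≈⟨ K.*-congˡ (⟨∣⟩-* ((K.- K.1#) ^ k) q _) ⟩
      (K.- K.1#) ^ n K.* ((K.- K.1#) ^ k K.* ⟨ q ∣ (λ i → 𝟙 (does (i ℕ.≟ k))) ⟩)
        ≈⟨ K.*-assoc _ _ _ ⟨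
      (K.- K.1#) ^ n K.* (K.- K.1#) ^ k K.* ⟨ q ∣ (λ i → 𝟙 (does (i ℕ.≟ k))) ⟩
        ≈⟨ K.*-cong (^-homo-* (K.- K.1#) n k) (coeff-as-⟨∣⟩ q k) ⟨
      (K.- K.1#) ^ (n ℕ.+ k) K.* coeff q k
        ≈⟨ desymmetrisation-sign k ⟩
      coeff q k ∎)
      where
      open Poly hiding (_^_)

      exponent : ∀ i → n PolyProps.· 0 ℕ.+ i PolyProps.· 1 ≡ i
      exponent i = ≡.cong₂ ℕ._+_ (≡.trans (n·d≡n*d n 0) (ℕ.*-zeroʳ n))
                                 (≡.trans (n·d≡n*d i 1) (ℕ.*-identityʳ i))

      term : ∀ i → (K.- K.1#) ^ i K.* 𝟙 (does (n PolyProps.· 0 ℕ.+ i PolyProps.· 1 ℕ.≟ k))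
                   K.≈ (K.- K.1#) ^ k K.* 𝟙 (does (i ℕ.≟ k))
      term i rewrite exponent i with i ℕ.≟ k
      ... | yes ≡.refl = K.refl
      ... | no i≢k rewrite dec-false (i ℕ.≟ k) i≢k = K.trans (K.zeroʳ _) (K.sym (K.zeroʳ _))

    -- At exponents from n upwards the coefficients agree by the construction of `q`; reflection
    -- about n carries the lower exponents there.
    desymmetrisation-symmetrisationIdentity :
      MultiplicativelySymmetric n p → SymmetrisationIdentity n p q
    desymmetrisation-symmetrisationIdentity ms =
      Equivalence.from (symmetrisationIdentity⇔ n p q) λ e → begin
        coeff² p e                          ≡⟨ ≡.cong (coeff² p) (recentre (+ n) e) ⟩
        coeff² p (+ n ℤ.+ (e ℤ.- + n))      ≈⟨ fold (e ℤ.- + n) ⟩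
        coeff² p (+ n ℤ.+ + ∣ e ℤ.- + n ∣)  ≈⟨ coeff-desymmetrisation ∣ e ℤ.- + n ∣ ⟨
        Poly.coeff q ∣ e ℤ.- + n ∣          ∎
      where
      recentre : ∀ a e → e ≡ a ℤ.+ (e ℤ.- a)
      recentre = solve-∀

      reflect : ∀ a m → a ℤ.* + 2 ℤ.- (a ℤ.+ m) ≡ a ℤ.+ ℤ.- m
      reflect = solve-∀

      fold : ∀ m → coeff² p (+ n ℤ.+ m) K.≈ coeff² p (+ n ℤ.+ + ∣ m ∣)
      fold (+ k)    = K.refl
      -- The exponent n - (k + 1) is reflected to n + (k + 1).
      fold -[1+ k ] = K.trans
        (K.sym (multiplicativelySymmetric⇒coeff²-reflect n p ms (+ n ℤ.+ -[1+ k ])))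
        (K.reflexive (≡.cong (coeff² p) (reflect (+ n) -[1+ k ])))

theorem2p4 : ∀ {c ℓ₁ ℓ₂} (K : HeytingField c ℓ₁ ℓ₂) → let open Polynomials K in
    ∀ (n : ℕ) (p : K[x]) → HasDegree n p →
    (MultiplicativelySymmetric n p
    ⇔ (∃[ q ] (HasDegree n q × AdditivelySymmetric n q × SymmetrisationIdentity n p q)))
    × (∀ (q q′ : K[x]) →
    HasDegree n q × AdditivelySymmetric n q × SymmetrisationIdentity n p q →
    HasDegree n q′ × AdditivelySymmetric n q′ × SymmetrisationIdentity n p q′ →
    q Poly.≈ q′)
theorem2p4 K n p deg =
  mk⇔ (λ ms → desymmetrisation K n p ,
              desymmetrisation-hasDegree K n p deg ,
              desymmetrisation-additivelySymmetric K n p ,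
              desymmetrisation-symmetrisationIdentity K n p ms)
      (λ (q , _ , _ , si) → symmetrisationIdentity⇒multiplicativelySymmetric K n p q si) ,
  -- Both coefficients at `k` equal the coefficient of p(x²) at n + k.
  (λ q q′ (_ , _ , si) (_ , _ , si′) k → HeytingField.trans K
    (symmetrisationIdentity⇒coeff K n p q si k)
    (HeytingField.sym K (symmetrisationIdentity⇒coeff K n p q′ si′ k)))
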